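{- Let $G$ be a finite graph with $n$ vertices and $t$ a positive integer with prime factorization $t=\prod_{i=1}^s p_i^{r_i}$. Write $Z_t\times Z_2=\{(\rho^i,\sigma^j): 0\le i\le t-1,\ j\in\{0,1\}\}$ (with $\rho$ of order $t$, $\sigma$ of order 2) and $D_t\times Z_2=\{(\rho^i,\sigma^j),(\tau\rho^i,\sigma^j): 0\le i\le t-1,\ j\in\{0,1\}\}$ (with $\rho,\tau$ the rotation and reflection generating $D_t$), and when $\mathrm{Aut}(G)$ is isomorphic to one of these groups denote by $\pi_g$ the automorphism corresponding to the group element $g$. Let $P_0^*=\{\pi_{(\rho^0,\sigma)}\}$ if $t$ is odd and $P_0^*=\{\pi_{(\rho^0,\sigma)},\pi_{(\rho^{t/2},\sigma)}\}$ if $t$ is even, and let $P^*=P_0^*\cup\{\pi_{(\rho^{t/p_i},\sigma^0)}: i=1,\dots,s\}$. Then for every positive integer $k$: (i) if $\mathrm{Aut}(G)\cong Z_t\times Z_2$, then $L(G,k)=\sum_{P\subseteq P^*}(-1)^{|P|}N_{\ge}(P)$; (ii) if $\mathrm{Aut}(G)\cong D_t\times Z_2$, then for $b\in\{0,1\}$ and $0\le i\le t-1$, $$N_=(\{\pi_{(\rho^0,\sigma^0)},\pi_{(\tau\rho^i,\sigma^b)}\})=\sum_{\{\pi_{(\tau\rho^i,\sigma^b)}\}\subseteq P\subseteq\{\pi_{(\tau\rho^i,\sigma^b)}\}\cup P^*}(-1)^{|P|-1}N_{\ge}(P),$$ and $$L(G,k)=\sum_{P\subseteq P^*}(-1)^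{|P|}N_{\ge}(P)-\sum_{b=0}^{1}\sum_{i=0}^{t-1}N_=(\{\pi_{(\rho^0,\sigma^0)},\pi_{(\tau\rho^i,\sigma^b)}\}).$$
   Context: A $k$-labeling of $G$ is a map $\phi:V(G)\to\{1,\dots,k\}$; an automorphism $\pi$ preserves $\phi$ if $\phi(\pi(v))=\phi(v)$ for all $v$; $\phi$ is distinguishing if only the identity preserves it; $L(G,k)$ is the number of distinguishing $k$-labelings. For $P\subseteq\mathrm{Aut}(G)$, $N_{\ge}(P)$ is the number of $k$-labelings preserved by every automorphism in $P$ (so $N_{\ge}(\emptyset)=k^n$), and $N_=(P)$ is the number of $k$-labelings whose set of preserving automorphisms is exactly $P$. -}

module Defs where

open import Level using (0ℓ)
open import Algebra.Bundles using (Group)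
open import Algebra.Morphism.Structures using (module GroupMorphisms)
open import Data.Bool.Base using (if_then_else_)
open import Data.Fin.Base using (Fin; finToFun; funToFin)
open import Data.Fin.Permutation as Perm using (Permutation′; _⟨$⟩ʳ_; _⟨$⟩ˡ_)
open import Data.Fin.Properties using (all?; _≟_; finToFun-funToFin)
open import Data.Integer.Base as ℤ using (ℤ; +_; 0ℤ)
open import Data.Integer.Divisibility.Signed using (divides) renaming (_∣_ to _∣ℤ_)
import Data.Integer.Properties as ℤₚ
open import Data.Integer.Tactic.RingSolver using (solve-∀)
open import Data.List.Base using (List; []; _∷_; [_]; _++_; map; foldr; filter; length; tabulate; allFin; deduplicate)
import Data.List.Membership.DecSetoid as Membership
import Data.List.Membership.Setoid.Properties as Membershipₚ
import Data.List.Relation.Binary.Subset.DecSetoid as Subset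
open import Data.List.Relation.Unary.All as All using (All)
open import Data.Nat.Base using (ℕ; _^_; _≤_)
open import Data.Nat.Divisibility using (_∣?_)
open import Data.Nat.DivMod using (_/_)
open import Data.Nat.ListAction using (product)
open import Data.Nat.Primality using (Prime; prime⇒nonZero)
open import Data.Product.Base using (_,_; _×_; proj₁; proj₂)
open import Function.Base using (_∘_)
open import Function.Bundles using (_⇔_; mk⇔; Equivalence)
open import Function.Definitions using (Injective)
open import Relation.Binary.Bundles using (DecSetoid)
open import Relation.Binary.Core using (Rel)
open import Relation.Binary.Definitions using (Irreflexive; Symmetric) renaming (Decidable to Decidable₂)
open import Relation.Binary.PropositionalEquality.Core using (_≡_; _≗_; refl; sym; trans; cong; cong₂; subst₂)
open import Relation.Nullary.Decidable.Core using (Dec; yes; no; does; map′; _×-dec_; _→-dec_)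
open import Relation.Nullary.Negation.Core using (contradiction)
open import Relation.Unary using (Pred; Decidable)

infix 4 _≅_

record _≅_ (A B : Group 0ℓ 0ℓ) : Set where
  private
    module A = Group A
    module B = Group B
  field
    ⟦_⟧                : A.Carrier → B.Carrier
    isGroupIsomorphism : GroupMorphisms.IsGroupIsomorphism A.rawGroup B.rawGroup ⟦_⟧

infix 4 _≡_⟨mod_⟩

record _≡_⟨mod_⟩ (i j : ℤ) (t : ℕ) : Set where
  constructor congruent
  field difference : + t ∣ℤ (i ℤ.- j)

module _ {t : ℕ} where

  ≡⇒≡mod : ∀ {i j} → i ≡ j → i ≡ j ⟨mod t ⟩
  ≡⇒≡mod {i} refl = congruent (divides 0ℤ (lemma i (+ t)))
    where
    lemma : ∀ i t → i ℤ.- i ≡ 0ℤ ℤ.* t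
    lemma = solve-∀

  mod-sym : ∀ {i j} → i ≡ j ⟨mod t ⟩ → j ≡ i ⟨mod t ⟩
  mod-sym {i} {j} (congruent (divides q eq)) =
    congruent (divides (ℤ.- q) (trans (lemma₁ i j) (trans (cong ℤ.-_ eq) (lemma₂ q (+ t)))))
    where
    lemma₁ : ∀ i j → j ℤ.- i ≡ ℤ.- (i ℤ.- j)
    lemma₁ = solve-∀
    lemma₂ : ∀ q t → ℤ.- (q ℤ.* t) ≡ ℤ.- q ℤ.* t
    lemma₂ = solve-∀

  mod-trans : ∀ {i j k} → i ≡ j ⟨mod t ⟩ → j ≡ k ⟨mod t ⟩ → i ≡ k ⟨mod t ⟩
  mod-trans {i} {j} {k} (congruent (divides p eq)) (congruent (divides q eq′)) =
    congruent (divides (p ℤ.+ q) (trans (lemma₁ i j k) (trans (cong₂ ℤ._+_ eq eq′) (lemma₂ p q (+ t)))))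
    where
    lemma₁ : ∀ i j k → i ℤ.- k ≡ (i ℤ.- j) ℤ.+ (j ℤ.- k)
    lemma₁ = solve-∀
    lemma₂ : ∀ p q t → p ℤ.* t ℤ.+ q ℤ.* t ≡ (p ℤ.+ q) ℤ.* t
    lemma₂ = solve-∀

  mod-+-cong : ∀ {i j k l} → i ≡ j ⟨mod t ⟩ → k ≡ l ⟨mod t ⟩ → i ℤ.+ k ≡ j ℤ.+ l ⟨mod t ⟩
  mod-+-cong {i} {j} {k} {l} (congruent (divides p eq)) (congruent (divides q eq′)) =
    congruent (divides (p ℤ.+ q) (trans (lemma₁ i j k l) (trans (cong₂ ℤ._+_ eq eq′) (lemma₂ p q (+ t)))))
    where
    lemma₁ : ∀ i j k l → (i ℤ.+ k) ℤ.- (j ℤ.+ l) ≡ (i ℤ.- j) ℤ.+ (k ℤ.- l)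
    lemma₁ = solve-∀
    lemma₂ : ∀ p q t → p ℤ.* t ℤ.+ q ℤ.* t ≡ (p ℤ.+ q) ℤ.* t
    lemma₂ = solve-∀

  mod-neg-cong : ∀ {i j} → i ≡ j ⟨mod t ⟩ → ℤ.- i ≡ ℤ.- j ⟨mod t ⟩
  mod-neg-cong {i} {j} (congruent (divides q eq)) =
    congruent (divides (ℤ.- q) (trans (lemma₁ i j) (trans (cong ℤ.-_ eq) (lemma₂ q (+ t)))))
    where
    lemma₁ : ∀ i j → ℤ.- i ℤ.- (ℤ.- j) ≡ ℤ.- (i ℤ.- j)
    lemma₁ = solve-∀
    lemma₂ : ∀ q t → ℤ.- (q ℤ.* t) ≡ ℤ.- q ℤ.* t
    lemma₂ = solve-∀

-- The integer i represents ρ^i; the order t is meant to be positive.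
Z : ℕ → Group 0ℓ 0ℓ
Z t = record
  { Carrier = ℤ
  ; _≈_     = _≡_⟨mod t ⟩
  ; _∙_     = ℤ._+_
  ; ε       = 0ℤ
  ; _⁻¹     = ℤ.-_
  ; isGroup = record
    { isMonoid = record
      { isSemigroup = record
        { isMagma = record
          { isEquivalence = record { refl = ≡⇒≡mod refl ; sym = mod-sym ; trans = mod-trans }
          ; ∙-cong = mod-+-cong
          }
        ; assoc = λ i j k → ≡⇒≡mod (ℤₚ.+-assoc i j k)
        }
      ; identity = (λ i → ≡⇒≡mod (ℤₚ.+-identityˡ i)) , (λ i → ≡⇒≡mod (ℤₚ.+-identityʳ i))
      }
    ; inverse = (λ i → ≡⇒≡mod (ℤₚ.+-inverseˡ i)) , (λ i → ≡⇒≡mod (ℤₚ.+-inverseʳ i))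
    ; ⁻¹-cong = mod-neg-cong
    }
  }

data Dihedral : Set where
  ρ^_ τρ^_ : ℤ → Dihedral

data DihedralEq (t : ℕ) : Rel Dihedral 0ℓ where
  ρ^-cong  : ∀ {i j} → i ≡ j ⟨mod t ⟩ → DihedralEq t (ρ^ i) (ρ^ j)
  τρ^-cong : ∀ {i j} → i ≡ j ⟨mod t ⟩ → DihedralEq t (τρ^ i) (τρ^ j)

infixl 7 _·_

-- Determined by τ² = 1 and ρ^i τ = τ ρ^(-i).
_·_ : Dihedral → Dihedral → Dihedral
(ρ^ i)  · (ρ^ j)  = ρ^ (i ℤ.+ j)
(ρ^ i)  · (τρ^ j) = τρ^ (ℤ.- i ℤ.+ j)
(τρ^ i) · (ρ^ j)  = τρ^ (i ℤ.+ j)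
(τρ^ i) · (τρ^ j) = ρ^ (ℤ.- i ℤ.+ j)

-- For t = 1 and t = 2 this is the group of order 2t with the usual
-- presentation ⟨ρ, τ | ρ^t, τ², (τρ)²⟩, not a group of permutations of t points.
D : ℕ → Group 0ℓ 0ℓ
D t = record
  { Carrier = Dihedral
  ; _≈_     = DihedralEq t
  ; _∙_     = _·_
  ; ε       = ρ^ 0ℤ
  ; _⁻¹     = inv
  ; isGroup = record
    { isMonoid = record
      { isSemigroup = record
        { isMagma = record
          { isEquivalence = record { refl = reflexive refl ; sym = D-sym ; trans = D-trans }
          ; ∙-cong = ·-cong
          }
        ; assoc = λ x y z → reflexive (·-assoc x y z)
        }
      ; identity = (λ x → reflexive (identityˡ x)) , (λ x → reflexive (identityʳ x))
      }
    ; inverse = (λ x → reflexive (inverseˡ x)) , (λ x → reflexive (inverseʳ x))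
    ; ⁻¹-cong = inv-cong
    }
  }
  where
  inv : Dihedral → Dihedral
  inv (ρ^ i)  = ρ^ (ℤ.- i)
  inv (τρ^ i) = τρ^ i

  reflexive : ∀ {x y} → x ≡ y → DihedralEq t x y
  reflexive {ρ^ i}  refl = ρ^-cong (≡⇒≡mod refl)
  reflexive {τρ^ i} refl = τρ^-cong (≡⇒≡mod refl)

  D-sym : ∀ {x y} → DihedralEq t x y → DihedralEq t y x
  D-sym (ρ^-cong p)  = ρ^-cong (mod-sym p)
  D-sym (τρ^-cong p) = τρ^-cong (mod-sym p)

  D-trans : ∀ {x y z} → DihedralEq t x y → DihedralEq t y z → DihedralEq t x z
  D-trans (ρ^-cong p)  (ρ^-cong q)  = ρ^-cong (mod-trans p q)
  D-trans (τρ^-cong p) (τρ^-cong q) = τρ^-cong (mod-trans p q)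

  ·-cong : ∀ {x y u v} → DihedralEq t x y → DihedralEq t u v → DihedralEq t (x · u) (y · v)
  ·-cong (ρ^-cong p)  (ρ^-cong q)  = ρ^-cong (mod-+-cong p q)
  ·-cong (ρ^-cong p)  (τρ^-cong q) = τρ^-cong (mod-+-cong (mod-neg-cong p) q)
  ·-cong (τρ^-cong p) (ρ^-cong q)  = τρ^-cong (mod-+-cong p q)
  ·-cong (τρ^-cong p) (τρ^-cong q) = ρ^-cong (mod-+-cong (mod-neg-cong p) q)

  inv-cong : ∀ {x y} → DihedralEq t x y → DihedralEq t (inv x) (inv y)
  inv-cong (ρ^-cong p)  = ρ^-cong (mod-neg-cong p)
  inv-cong (τρ^-cong p) = τρ^-cong p

  lemma₁ : ∀ i j k → ℤ.- (i ℤ.+ j) ℤ.+ k ≡ ℤ.- j ℤ.+ (ℤ.- i ℤ.+ k)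
  lemma₁ = solve-∀

  lemma₂ : ∀ i j k → ℤ.- (ℤ.- i ℤ.+ j) ℤ.+ k ≡ i ℤ.+ (ℤ.- j ℤ.+ k)
  lemma₂ = solve-∀

  ·-assoc : ∀ x y z → (x · y) · z ≡ x · (y · z)
  ·-assoc (ρ^ i)  (ρ^ j)  (ρ^ k)  = cong ρ^_ (ℤₚ.+-assoc i j k)
  ·-assoc (ρ^ i)  (ρ^ j)  (τρ^ k) = cong τρ^_ (trans (cong (λ m → ℤ.- m ℤ.+ k) (ℤₚ.+-comm i j)) (lemma₁ j i k))
  ·-assoc (ρ^ i)  (τρ^ j) (ρ^ k)  = cong τρ^_ (ℤₚ.+-assoc (ℤ.- i) j k)
  ·-assoc (ρ^ i)  (τρ^ j) (τρ^ k) = cong ρ^_ (lemma₂ i j k)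
  ·-assoc (τρ^ i) (ρ^ j)  (ρ^ k)  = cong τρ^_ (ℤₚ.+-assoc i j k)
  ·-assoc (τρ^ i) (ρ^ j)  (τρ^ k) = cong ρ^_ (trans (cong (λ m → ℤ.- m ℤ.+ k) (ℤₚ.+-comm i j)) (lemma₁ j i k))
  ·-assoc (τρ^ i) (τρ^ j) (ρ^ k)  = cong ρ^_ (ℤₚ.+-assoc (ℤ.- i) j k)
  ·-assoc (τρ^ i) (τρ^ j) (τρ^ k) = cong τρ^_ (lemma₂ i j k)

  identityˡ : ∀ x → ρ^ 0ℤ · x ≡ x
  identityˡ (ρ^ i)  = cong ρ^_ (ℤₚ.+-identityˡ i)
  identityˡ (τρ^ i) = cong τρ^_ (ℤₚ.+-identityˡ i)

  identityʳ : ∀ x → x · ρ^ 0ℤ ≡ x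
  identityʳ (ρ^ i)  = cong ρ^_ (ℤₚ.+-identityʳ i)
  identityʳ (τρ^ i) = cong τρ^_ (ℤₚ.+-identityʳ i)

  inverseˡ : ∀ x → inv x · x ≡ ρ^ 0ℤ
  inverseˡ (ρ^ i)  = cong ρ^_ (ℤₚ.+-inverseˡ i)
  inverseˡ (τρ^ i) = cong ρ^_ (ℤₚ.+-inverseˡ i)

  inverseʳ : ∀ x → x · inv x ≡ ρ^ 0ℤ
  inverseʳ (ρ^ i)  = cong ρ^_ (ℤₚ.+-inverseʳ i)
  inverseʳ (τρ^ i) = cong ρ^_ (ℤₚ.+-inverseˡ i)

record Graph (n : ℕ) : Set₁ where
  infix 4 _~_ _~?_
  field
    _~_    : Rel (Fin n) 0ℓ
    _~?_   : Decidable₂ _~_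
    ~-sym  : Symmetric _~_
    ~-irr  : Irreflexive _≡_ _~_

record Automorphism {n : ℕ} (G : Graph n) : Set where
  open Graph G
  field
    perm     : Permutation′ n
    respects : ∀ u v → u ~ v ⇔ perm ⟨$⟩ʳ u ~ perm ⟨$⟩ʳ v

  infixr 5 _$_
  _$_ : Fin n → Fin n
  _$_ = perm ⟨$⟩ʳ_

open Automorphism using (_$_)

module _ {n : ℕ} (G : Graph n) where
  open Graph G
  private module ⇔ = Equivalence

  infix 4 _≈ᴬ_
  _≈ᴬ_ : Rel (Automorphism G) 0ℓ
  π ≈ᴬ π′ = ∀ v → π $ v ≡ π′ $ v

  idᴬ : Automorphism G
  idᴬ = record { perm = Perm.id ; respects = λ u v → mk⇔ (λ p → p) (λ p → p) }

  infixr 9 _∘ᴬ_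
  _∘ᴬ_ : Automorphism G → Automorphism G → Automorphism G
  π ∘ᴬ π′ = record
    { perm     = π′.perm Perm.∘ₚ π.perm   -- _∘ₚ_ composes in diagrammatic order
    ; respects = λ u v → mk⇔
        (⇔.to (π.respects _ _) ∘ ⇔.to (π′.respects u v))
        (⇔.from (π′.respects u v) ∘ ⇔.from (π.respects _ _))
    }
    where
    module π  = Automorphism π
    module π′ = Automorphism π′

  _⁻¹ᴬ : Automorphism G → Automorphism G
  π ⁻¹ᴬ = record
    { perm     = Perm.flip perm
    ; respects = λ u v → mk⇔
        (λ u~v → ⇔.from (respects _ _) (subst₂ _~_ (sym (Perm.inverseʳ perm)) (sym (Perm.inverseʳ perm)) u~v))
        (λ u~v → subst₂ _~_ (Perm.inverseʳ perm) (Perm.inverseʳ perm) (⇔.to (respects _ _) u~v))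
    }
    where open Automorphism π

  Aut : Group 0ℓ 0ℓ
  Aut = record
    { Carrier = Automorphism G
    ; _≈_     = _≈ᴬ_
    ; _∙_     = _∘ᴬ_
    ; ε       = idᴬ
    ; _⁻¹     = _⁻¹ᴬ
    ; isGroup = record
      { isMonoid = record
        { isSemigroup = record
          { isMagma = record
            { isEquivalence = record
              { refl  = λ v → refl
              ; sym   = λ p v → sym (p v)
              ; trans = λ p q v → trans (p v) (q v)
              }
            ; ∙-cong = λ {π} {_} {_} {π′} p q v → trans (cong (π $_) (q v)) (p (π′ $ v))
            }
          ; assoc = λ _ _ _ _ → refl
          }
        ; identity = (λ _ _ → refl) , (λ _ _ → refl)
        }
      ; inverse = (λ π v → Perm.inverseˡ (Automorphism.perm π)) , (λ π v → Perm.inverseʳ (Automorphism.perm π))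
      ; ⁻¹-cong = λ {π} {π′} p v → trans
          (cong (π ⁻¹ᴬ $_) (trans (sym (Perm.inverseʳ (Automorphism.perm π′))) (sym (p _))))
          (Perm.inverseˡ (Automorphism.perm π))
      }
    }

  infix 4 _≈ᴬ?_
  _≈ᴬ?_ : Decidable₂ _≈ᴬ_
  π ≈ᴬ? π′ = all? λ v → (π $ v) ≟ (π′ $ v)

  Aut-decSetoid : DecSetoid 0ℓ 0ℓ
  Aut-decSetoid = record
    { Carrier = Automorphism G
    ; _≈_     = _≈ᴬ_
    ; isDecEquivalence = record { isEquivalence = Group.isEquivalence Aut ; _≟_ = _≈ᴬ?_ }
    }

  allᴬ? : ∀ {Q : Pred (Automorphism G) 0ℓ} → (∀ {π π′} → π ≈ᴬ π′ → Q π → Q π′) →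
          Decidable Q → Dec (∀ π → Q π)
  allᴬ? {Q} resp Q? = map′ sound complete (all? λ i → all? λ j → decide (finToFun i) (finToFun j))
    where
    Inv : (f g : Fin n → Fin n) → Set
    Inv f g = (∀ v → f (g v) ≡ v) × (∀ v → g (f v) ≡ v)

    Pres : (f : Fin n → Fin n) → Set
    Pres f = ∀ u v → (u ~ v → f u ~ f v) × (f u ~ f v → u ~ v)

    C : (f g : Fin n → Fin n) → Set
    C f g = ∀ π → (π $_) ≗ f → (Automorphism.perm π ⟨$⟩ˡ_) ≗ g → Q π

    inv? : ∀ f g → Dec (Inv f g)
    inv? f g = all? (λ v → f (g v) ≟ v) ×-dec all? (λ v → g (f v) ≟ v)

    pres? : ∀ f → Dec (Pres f)
    pres? f = all? λ u → all? λ v → ((u ~? v) →-dec (f u ~? f v)) ×-dec ((f u ~? f v) →-dec (u ~? v))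

    toInv : ∀ {f g} (π : Automorphism G) → (π $_) ≗ f → (Automorphism.perm π ⟨$⟩ˡ_) ≗ g → Inv f g
    toInv {f} {g} π p q =
      (λ v → trans (sym (p (g v))) (trans (cong (π $_) (sym (q v))) (Perm.inverseʳ perm))) ,
      (λ v → trans (sym (q (f v))) (trans (cong (perm ⟨$⟩ˡ_) (sym (p v))) (Perm.inverseˡ perm)))
      where open Automorphism π using (perm)

    toPres : ∀ {f} (π : Automorphism G) → (π $_) ≗ f → Pres f
    toPres π p u v =
      (λ r → subst₂ _~_ (p u) (p v) (⇔.to (respects u v) r)) ,
      (λ r → ⇔.from (respects u v) (subst₂ _~_ (sym (p u)) (sym (p v)) r))
      where open Automorphism π using (respects)

    decide : ∀ f g → Dec (C f g)
    decide f g with inv? f g | pres? f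
    ... | no ¬i         | _     = yes λ π p q → contradiction (toInv π p q) ¬i
    ... | yes _         | no ¬p = yes λ π p q → contradiction (toPres π p) ¬p
    ... | yes (fg , gf) | yes r = map′ (λ Qα π p q → resp (λ v → sym (p v)) Qα)
                                       (λ c → c α (λ _ → refl) (λ _ → refl)) (Q? α)
      where
      α : Automorphism G
      α = record
        { perm     = Perm.permutation f g fg gf
        ; respects = λ u v → mk⇔ (proj₁ (r u v)) (proj₂ (r u v))
        }

    sound : (∀ i j → C (finToFun i) (finToFun j)) → ∀ π → Q π
    sound c π = c (funToFin (π $_)) (funToFin (perm ⟨$⟩ˡ_)) π
      (λ v → sym (finToFun-funToFin (π $_) v)) (λ v → sym (finToFun-funToFin (perm ⟨$⟩ˡ_) v))
      where open Automorphism π using (perm)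

    complete : (∀ π → Q π) → ∀ i j → C (finToFun i) (finToFun j)
    complete q _ _ π _ _ = q π

Labeling : ℕ → ℕ → Set
Labeling n k = Fin n → Fin k

-- finToFun enumerates the functions Fin n → Fin k by Fin (k ^ n), each once
-- up to pointwise equality.
#labelings : ∀ {n k} {Q : Pred (Labeling n k) 0ℓ} → Decidable Q → ℕ
#labelings {n} {k} Q? = length (filter (λ i → Q? (finToFun i)) (allFin (k ^ n)))

sublists : {A : Set} → List A → List (List A)
sublists []       = [ [] ]
sublists (x ∷ xs) = map (x ∷_) (sublists xs) ++ sublists xs

-- A finite set of automorphisms is given by a list of its elements; order and
-- repetitions are immaterial in _∈_, N≥ and N=.
module _ {n : ℕ} (G : Graph n) where

  open Membership (Aut-decSetoid G) using (_∈_; _∈?_)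
  open Subset (Aut-decSetoid G) using (_⊆?_)

  Preserves : ∀ {k} → Automorphism G → Labeling n k → Set
  Preserves π φ = ∀ v → φ (π $ v) ≡ φ v

  preserves? : ∀ {k} (π : Automorphism G) → Decidable (Preserves {k} π)
  preserves? π φ = all? λ v → φ (π $ v) ≟ φ v

  Preserves-resp : ∀ {k} (φ : Labeling n k) π π′ → _≈ᴬ_ G π π′ → Preserves π φ → Preserves π′ φ
  Preserves-resp φ π π′ p pres v = trans (cong φ (sym (p v))) (pres v)

  Distinguishing : ∀ {k} → Labeling n k → Set
  Distinguishing φ = ∀ π → Preserves π φ → _≈ᴬ_ G π (idᴬ G)

  distinguishing? : ∀ {k} → Decidable (Distinguishing {k})
  distinguishing? φ = allᴬ? G
    (λ {π} {π′} p d pres v → trans (sym (p v)) (d (Preserves-resp φ π′ π (λ v → sym (p v)) pres) v))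
    (λ π → preserves? π φ →-dec _≈ᴬ?_ G π (idᴬ G))

  PreservedByAll : ∀ {k} → List (Automorphism G) → Labeling n k → Set
  PreservedByAll P φ = All (λ π → Preserves π φ) P

  preservedByAll? : ∀ {k} P → Decidable (PreservedByAll {k} P)
  preservedByAll? P φ = All.all? (λ π → preserves? π φ) P

  PreservedExactlyBy : ∀ {k} → List (Automorphism G) → Labeling n k → Set
  PreservedExactlyBy P φ = ∀ π → Preserves π φ ⇔ π ∈ P

  preservedExactlyBy? : ∀ {k} P → Decidable (PreservedExactlyBy {k} P)
  preservedExactlyBy? P φ = allᴬ? G
    (λ {π} {π′} p e → mk⇔
      (λ pres → ∈-resp π π′ p (Equivalence.to e (Preserves-resp φ π′ π (λ v → sym (p v)) pres)))
      (λ π∈ → Preserves-resp φ π π′ p (Equivalence.from e (∈-resp π′ π (λ v → sym (p v)) π∈))))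
    (λ π → map′ (λ (f , g) → mk⇔ f g) (λ e → Equivalence.to e , Equivalence.from e)
      ((preserves? π φ →-dec (π ∈? P)) ×-dec ((π ∈? P) →-dec preserves? π φ)))
    where
    ∈-resp : ∀ π π′ → _≈ᴬ_ G π π′ → π ∈ P → π′ ∈ P
    ∈-resp π π′ p = Membershipₚ.∈-resp-≈ (DecSetoid.setoid (Aut-decSetoid G)) {P} {π} {π′} p

  L : ℕ → ℕ
  L k = #labelings (distinguishing? {k})

  N≥ : ℕ → List (Automorphism G) → ℕ
  N≥ k P = #labelings (preservedByAll? {k} P)

  N= : ℕ → List (Automorphism G) → ℕ
  N= k P = #labelings (preservedExactlyBy? {k} P)

  -- All subsets of the set of elements of B, each listed once and without
  -- repetitions, so that the length of each is its cardinality.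
  subsets : List (Automorphism G) → List (List (Automorphism G))
  subsets B = sublists (deduplicate (_≈ᴬ?_ G) B)

  between : (A B : List (Automorphism G)) → List (List (Automorphism G))
  between A B = filter (A ⊆?_) (subsets B)

∑ : {A : Set} → List A → (A → ℤ) → ℤ
∑ xs f = foldr ℤ._+_ 0ℤ (map f xs)

infix 5 ∑
syntax ∑ xs (λ x → e) = ∑[ x ∈ xs ] e

record PrimeFactorization (t : ℕ) : Set where
  field
    s          : ℕ
    p r        : Fin s → ℕ
    p-prime    : ∀ i → Prime (p i)
    p-distinct : Injective _≡_ _≡_ p
    r-positive : ∀ i → 1 ≤ r i
    factors    : t ≡ product (tabulate λ i → p i ^ r i)

-- The argument π stands for (i , j) ↦ π_(ρ^i , σ^j).
module _ {A : Set} {t : ℕ} (F : PrimeFactorization t) (π : ℕ → ℕ → A) where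
  open PrimeFactorization F

  P₀* : List A
  P₀* = if does (2 ∣? t) then π 0 1 ∷ π (t / 2) 1 ∷ [] else π 0 1 ∷ []

  P* : List A
  P* = P₀* ++ tabulate λ i → π ((t / p i) {{prime⇒nonZero (p-prime i)}}) 0

{-# OPTIONS --safe #-}

-- For a fixed labeling the automorphisms preserving it form a subgroup S.  A
-- nontrivial subgroup of Z_t × Z_2 contains an element of prime order, hence
-- some element of P*, and P* does not contain the identity; so S meets the
-- rotations trivially exactly when no element of P* preserves the labeling, and
-- the labelings with this property are counted by inclusion-exclusion.  In the
-- dihedral case two reflections in S differ by a rotation in S, so that such an
-- S is trivial or {1, g} for a unique reflection g.  Each identity is proved
-- for the indicator functions of a single labeling and then summed.
module Submission where

open import Defs
open import Level using (0ℓ)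
open import Algebra.Bundles using (Group)
open import Algebra.Construct.DirectProduct using () renaming (group to _×ᴳ_)
open import Algebra.Morphism.Structures using (module GroupMorphisms)
open import Data.Bool.Base using (if_then_else_)
open import Data.Fin.Base using (Fin; toℕ; finToFun)
import Data.Fin.Permutation as Perm
open import Data.Integer.Base as ℤ using (ℤ; +_; -[1+_]; 0ℤ; 1ℤ; -1ℤ; _-_; _*_; _^_; ∣_∣)
open import Data.Integer.Divisibility.Signed as ℤ∣ using (divides)
open import Data.Integer.DivMod using (_%ℕ_; _/ℕ_; n%ℕd<d; a≡a%ℕn+[a/ℕn]*n)
import Data.Integer.Properties as ℤₚ
open import Data.Integer.Tactic.RingSolver using (solve-∀)
open import Data.List.Base using (List; []; _∷_; [_]; _++_; map; filter; deduplicate; length; upTo; allFin)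
open import Data.List.Membership.Propositional using (_∈_; lose; find)
open import Data.List.Membership.Propositional.Properties using (∈-tabulate⁺; ∈-upTo⁺; ∈-upTo⁻)
open import Data.List.Properties using (filter-all; filter-none; filter-++; ++-identityʳ)
import Data.List.Relation.Binary.Subset.DecSetoid as Subset
open import Data.List.Relation.Unary.All as All using (All; []; _∷_)
import Data.List.Relation.Unary.All.Properties as Allₚ
open import Data.List.Relation.Unary.AllPairs using (_∷_)
open import Data.List.Relation.Unary.Any as Any using (Any; here; there)
import Data.List.Relation.Unary.Any.Properties as Anyₚ
open import Data.List.Relation.Unary.Unique.Propositional using (Unique)
open import Data.List.Relation.Unary.Unique.Propositional.Properties using (upTo⁺)
open import Data.Nat.Base as ℕ using (ℕ; zero; suc; NonZero; _∸_)
open import Data.Nat.Divisibility as ℕ∣ using (_∣_; _∣?_)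
open import Data.Nat.DivMod using (_/_; m/n<m; m/n*n≡m; m*n/n≡m)
open import Data.Nat.GCD using (gcd; gcd-GCD; gcd[m,n]∣m; gcd[m,n]∣n; module Bézout)
open import Data.Nat.ListAction using (product)
open import Data.Nat.ListAction.Properties using (∈⇒∣product)
open import Data.Nat.Primality using (Prime; prime⇒nonZero; prime⇒nonTrivial; prime⇒irreducible; ¬prime[1]; euclidsLemma)
open import Data.Nat.Primality.Factorisation using (factorise)
import Data.Nat.Properties as ℕₚ
open import Data.Product.Base using (_,_; _×_; ∃; proj₁; proj₂)
open import Data.Sum.Base using (inj₁; inj₂)
open import Function.Base using (_∘_)
open import Function.Bundles using (_⇔_; mk⇔; Equivalence)
open import Relation.Binary.PropositionalEquality.Core using (_≡_; _≢_; refl; sym; trans; cong; cong₂; subst)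
open import Relation.Binary.PropositionalEquality.Properties using (module ≡-Reasoning)
open import Relation.Nullary.Decidable using (Dec; yes; no; does; ¬?; _×-dec_; map′; dec-true; dec-false)
open import Relation.Nullary.Negation.Core using (¬_; contradiction)
open import Relation.Unary using (Pred; Decidable)

open ≡-Reasoning

-- Congruences and parity.

infix 4 _≡?_⟨mod_⟩

_≡?_⟨mod_⟩ : ∀ i j t → Dec (i ≡ j ⟨mod t ⟩)
i ≡? j ⟨mod t ⟩ = map′ congruent _≡_⟨mod_⟩.difference (+ t ℤ∣.∣? (i - j))

module _ {t : ℕ} where

  ≡0⇒∣ : ∀ {i} → i ≡ 0ℤ ⟨mod t ⟩ → t ∣ ∣ i ∣
  ≡0⇒∣ {i} (congruent d) = ℤ∣.∣⇒∣ᵤ (subst (+ t ℤ∣.∣_) (ℤₚ.+-identityʳ i) d)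

  ∣⇒≡0 : ∀ {i} → t ∣ ∣ i ∣ → i ≡ 0ℤ ⟨mod t ⟩
  ∣⇒≡0 {i} d = congruent (subst (+ t ℤ∣.∣_) (sym (ℤₚ.+-identityʳ i)) (ℤ∣.∣ᵤ⇒∣ d))

  ≡+*⇒≡mod : ∀ {i j} q → i ≡ j ℤ.+ q * + t → i ≡ j ⟨mod t ⟩
  ≡+*⇒≡mod {i} {j} q eq = congruent (divides q (trans (cong (_- j) eq) (lemma j (q * + t))))
    where
    lemma : ∀ j u → (j ℤ.+ u) - j ≡ u
    lemma = solve-∀

  ≡mod-%ℕ : ∀ i .{{_ : NonZero t}} → i ≡ + (i %ℕ t) ⟨mod t ⟩
  ≡mod-%ℕ i = ≡+*⇒≡mod (i /ℕ t) (a≡a%ℕn+[a/ℕn]*n i t)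

  -≡0⇒≡mod : ∀ {i j} → ℤ.- i ℤ.+ j ≡ 0ℤ ⟨mod t ⟩ → j ≡ i ⟨mod t ⟩
  -≡0⇒≡mod {i} {j} p = mod-trans (≡⇒≡mod (lemma i j))
    (mod-trans (mod-+-cong (≡⇒≡mod {i = i} refl) p) (≡⇒≡mod (ℤₚ.+-identityʳ i)))
    where
    lemma : ∀ i j → j ≡ i ℤ.+ (ℤ.- i ℤ.+ j)
    lemma = solve-∀

  -- The distance between `m` and `n` is a multiple of `t` smaller than `t`, hence zero. This turns
  -- congruent exponents in the index range of a sum into equal indices.
  ≡mod⇒≡ : ∀ {m n} → m ℕ.< t → n ℕ.< t → + m ≡ + n ⟨mod t ⟩ → m ≡ n
  ≡mod⇒≡ {m} {n} m<t n<t (congruent d) = go (ℕₚ.≤-total m n)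
    where
    zero-difference : ∀ {k} → k ℕ.< t → t ∣ k → k ≡ 0
    zero-difference {zero}  _   _   = refl
    zero-difference {suc k} k<t t∣k = contradiction (ℕ∣.∣⇒≤ t∣k) (ℕₚ.<⇒≱ k<t)
    t∣m⊖n : t ∣ ∣ m ℤ.⊖ n ∣
    t∣m⊖n = subst (λ i → t ∣ ∣ i ∣) (ℤₚ.m-n≡m⊖n m n) (ℤ∣.∣⇒∣ᵤ d)
    go : _ → m ≡ n
    go (inj₁ m≤n) = ℕₚ.≤-antisym m≤n (ℕₚ.m∸n≡0⇒m≤n (zero-difference
      (ℕₚ.≤-<-trans (ℕₚ.m∸n≤m n m) n<t) (subst (t ∣_) (ℤₚ.∣⊖∣-≤ m≤n) t∣m⊖n)))
    go (inj₂ n≤m) = ℕₚ.≤-antisym (ℕₚ.m∸n≡0⇒m≤n (zero-difference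
      (ℕₚ.≤-<-trans (ℕₚ.m∸n≤m m n) m<t) (subst (t ∣_) (cong ∣_∣ (ℤₚ.⊖-≥ n≤m)) t∣m⊖n))) n≤m

data Parity (i : ℤ) : Set where
  even : ∀ q → i ≡ q * + 2 → Parity i
  odd  : ∀ q → i ≡ + 1 ℤ.+ q * + 2 → Parity i

parity : ∀ i → Parity i
parity i with i %ℕ 2 | n%ℕd<d i 2 | a≡a%ℕn+[a/ℕn]*n i 2
... | 0 | _ | eq = even (i /ℕ 2) (trans eq (ℤₚ.+-identityˡ _))
... | 1 | _ | eq = odd (i /ℕ 2) eq
... | suc (suc _) | ℕ.s≤s (ℕ.s≤s ()) | _

-- Write 2i = qt. If q = 2r, then i = rt, which is excluded. If q = 1 + 2r, then t = qt - 2rt = 2(i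
-- - rt) is even, and halving 2i = qt gives i = t/2 + rt.
double≡0 : ∀ {t i} → i ℤ.+ i ≡ 0ℤ ⟨mod t ⟩ → ¬ i ≡ 0ℤ ⟨mod t ⟩ →
           2 ∣ t × i ≡ + (t / 2) ⟨mod t ⟩
double≡0 {t} {i} (congruent (divides q eq)) i≢0 = go (parity q)
  where
  lemma₁ : ∀ i → (i ℤ.+ i) - 0ℤ ≡ i * + 2
  lemma₁ = solve-∀
  lemma₂ : ∀ q t → q * + 2 * t ≡ (0ℤ ℤ.+ q * t) * + 2
  lemma₂ = solve-∀
  lemma₃ : ∀ q t → t ≡ (+ 1 ℤ.+ q * + 2) * t - q * t * + 2
  lemma₃ = solve-∀
  lemma₄ : ∀ i q t → i * + 2 - q * t * + 2 ≡ (i - q * t) * + 2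
  lemma₄ = solve-∀
  lemma₅ : ∀ q h → (+ 1 ℤ.+ q * + 2) * (h * + 2) ≡ (h ℤ.+ q * (h * + 2)) * + 2
  lemma₅ = solve-∀
  eq′ : i * + 2 ≡ q * + t
  eq′ = trans (sym (lemma₁ i)) eq
  go : Parity q → _
  go (even r refl) = contradiction
    (≡+*⇒≡mod r (ℤₚ.*-cancelʳ-≡ i (0ℤ ℤ.+ r * + t) (+ 2) (trans eq′ (lemma₂ r (+ t))))) i≢0
  go (odd r refl) = 2∣t , ≡+*⇒≡mod r (ℤₚ.*-cancelʳ-≡ i _ (+ 2)
    (trans eq′ (trans (cong ((+ 1 ℤ.+ r * + 2) *_) t≡) (trans (lemma₅ r (+ (t / 2)))
      (cong (λ u → (+ (t / 2) ℤ.+ r * u) * + 2) (sym t≡))))))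
    where
    2∣t : 2 ∣ t
    2∣t = ℤ∣.∣⇒∣ᵤ {+ 2} {+ t} (divides (i - r * + t)
      (trans (lemma₃ r (+ t)) (trans (cong (λ u → u - r * + t * + 2) (sym eq′)) (lemma₄ i r (+ t)))))
    t≡ : + t ≡ + (t / 2) * + 2
    t≡ = trans (cong +_ (sym (m/n*n≡m 2∣t))) (ℤₚ.pos-* (t / 2) 2)

-- Prime divisors of t.

prime∣product : ∀ {q} → Prime q → ∀ ms → q ∣ product ms → Any (q ∣_) ms
prime∣product pr []       q∣1 = contradiction (subst Prime (ℕ∣.∣1⇒≡1 q∣1) pr) ¬prime[1]
prime∣product pr (m ∷ ms) q∣  with euclidsLemma m (product ms) pr q∣
... | inj₁ q∣m  = here q∣m
... | inj₂ q∣ms = there (prime∣product pr ms q∣ms)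

prime∣^ : ∀ {q} → Prime q → ∀ m r → q ∣ m ℕ.^ r → q ∣ m
prime∣^ pr m zero    q∣1 = contradiction (subst Prime (ℕ∣.∣1⇒≡1 q∣1) pr) ¬prime[1]
prime∣^ pr m (suc r) q∣  with euclidsLemma m (m ℕ.^ r) pr q∣
... | inj₁ q∣m  = q∣m
... | inj₂ q∣m^ = prime∣^ pr m r q∣m^

prime∣prime⇒≡ : ∀ {q p} → Prime q → Prime p → q ∣ p → q ≡ p
prime∣prime⇒≡ q-prime p-prime q∣p with prime⇒irreducible p-prime q∣p
... | inj₁ q≡1 = contradiction (subst Prime q≡1 q-prime) ¬prime[1]
... | inj₂ q≡p = q≡p

∃-prime∣ : ∀ m .{{_ : NonZero m}} → m ≢ 1 → ∃ λ q → Prime q × q ∣ m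
∃-prime∣ m m≢1 with factorise m
... | record { factors = [] ; isFactorisation = eq } = contradiction eq m≢1
... | record { factors = q ∷ qs ; isFactorisation = eq ; factorsPrime = pr ∷ _ } =
  q , pr , subst (q ∣_) (sym eq) (ℕ∣.m∣m*n (product qs))

-- The quotient is positive and smaller than `t`. For a prime divisor `m` of `t` this says that the
-- rotation by `t / m` is not the identity.
∤quotient : ∀ {t m} .{{_ : NonZero t}} .{{_ : NonZero m}} → 1 ℕ.< m → m ∣ t → ¬ t ∣ t / m
∤quotient {t} {m} 1<m m∣t t∣t/m = ℕₚ.<⇒≱ (m/n<m t m 1<m) (ℕ∣.∣⇒≤ {{nonZero}} t∣t/m)
  where
  nonZero : NonZero (t / m)
  nonZero = ℕ.≢-nonZero λ eq → ℕ.≢-nonZero⁻¹ t (trans (sym (m/n*n≡m m∣t)) (cong (ℕ._* m) eq))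

module _ {t : ℕ} (F : PrimeFactorization t) where
  open PrimeFactorization F

  p∣t : ∀ i → p i ∣ t
  p∣t i = ℕ∣.∣-trans (p∣p^r (r i) (r-positive i))
    (subst (p i ℕ.^ r i ∣_) (sym factors) (∈⇒∣product (∈-tabulate⁺ i)))
    where
    p∣p^r : ∀ r → 1 ℕ.≤ r → p i ∣ p i ℕ.^ r
    p∣p^r (suc r) _ = ℕ∣.m∣m*n (p i ℕ.^ r)

  -- Euclid's lemma, applied to the product and then to the power, leaves a prime dividing some
  -- prime `p i`.
  prime∣t⇒p : ∀ {q} → Prime q → q ∣ t → ∃ λ i → q ≡ p i
  prime∣t⇒p pr q∣t =
    let i , q∣p^r = Anyₚ.tabulate⁻ (prime∣product pr _ (subst (_ ∣_) factors q∣t))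
    in i , prime∣prime⇒≡ pr (p-prime i) (prime∣^ pr (p i) (r i) q∣p^r)

-- Subgroups of Z_t.

record IsSubgroup (K : Group 0ℓ 0ℓ) (S : Pred (Group.Carrier K) 0ℓ) : Set where
  open Group K
  field
    resp : ∀ {x y} → x ≈ y → S x → S y
    ε∈   : S ε
    ∙∈   : ∀ {x y} → S x → S y → S (x ∙ y)
    ⁻¹∈  : ∀ {x} → S x → S (x ⁻¹)

module _ {t : ℕ} {S : Pred ℤ 0ℓ} (S-subgroup : IsSubgroup (Z t) S) where
  open IsSubgroup S-subgroup

  *∈ : ∀ m {i} → S i → S (m * i)
  *∈ (+ m)    s = ℕ*∈ m s
    where
    ℕ*∈ : ∀ m {i} → S i → S (+ m * i)
    ℕ*∈ zero    s = ε∈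
    ℕ*∈ (suc m) {i} s = subst S (sym (ℤₚ.suc-* (+ m) i)) (∙∈ s (ℕ*∈ m s))
  *∈ -[1+ m ] {i} s = subst S (ℤₚ.neg-distribˡ-* (+ suc m) i) (⁻¹∈ (*∈ (+ suc m) s))

  ∣∣∈ : ∀ {i} → S i → S (+ ∣ i ∣)
  ∣∣∈ {+ _}      s = s
  ∣∣∈ { -[1+ _ ]} s = ⁻¹∈ s

  -- Bézout over the naturals gives either d + yt = x|i| or d + x|i| = yt. Modulo `t` the gcd d is
  -- therefore congruent to x|i| or to -x|i|, and both lie in `S`.
  gcd∈ : ∀ {i} → S i → S (+ gcd ∣ i ∣ t)
  gcd∈ {i} s with Bézout.identity (gcd-GCD ∣ i ∣ t)
  ... | Bézout.+- x y eq = resp (≡+*⇒≡mod (+ y)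
    (trans (sym (ℤₚ.pos-* x ∣ i ∣)) (trans (cong +_ (sym eq))
      (trans (ℤₚ.pos-+ (gcd ∣ i ∣ t) (y ℕ.* t)) (cong (λ u → + gcd ∣ i ∣ t ℤ.+ u) (ℤₚ.pos-* y t))))))
    (*∈ (+ x) (∣∣∈ s))
  ... | Bézout.-+ x y eq = resp (≡+*⇒≡mod (ℤ.- + y)
    (trans (lemma₁ (+ d) (+ x * + ∣ i ∣)) (trans (cong (λ u → + d - u) eq′) (lemma₂ (+ d) (+ y) (+ t)))))
    (⁻¹∈ (*∈ (+ x) (∣∣∈ s)))
    where
    d = gcd ∣ i ∣ t
    lemma₁ : ∀ d u → ℤ.- u ≡ d - (d ℤ.+ u)
    lemma₁ = solve-∀
    lemma₂ : ∀ d y t → d - y * t ≡ d ℤ.+ ℤ.- y * t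
    lemma₂ = solve-∀
    eq′ : + d ℤ.+ + x * + ∣ i ∣ ≡ + y * + t
    eq′ = trans (cong (λ u → + d ℤ.+ u) (sym (ℤₚ.pos-* x ∣ i ∣))) (trans (cong +_ eq) (ℤₚ.pos-* y t))

  -- Let d be the gcd of |i| and t, and t = qd. As `t` does not divide `i`, q is not 1 and has a
  -- prime factor, which is some `p j`. With q = e `p j`, the quotient `t / p j` equals ed, a
  -- multiple of the element d of `S`.
  prime-quotient∈ : .{{_ : NonZero t}} (F : PrimeFactorization t) → let open PrimeFactorization F in
    ∀ {i} → S i → ¬ i ≡ 0ℤ ⟨mod t ⟩ → ∃ λ j → S (+ ((t / p j) {{prime⇒nonZero (p-prime j)}}))
  prime-quotient∈ F {i} s i≢0 = go (gcd[m,n]∣n ∣ i ∣ t)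
    where
    d = gcd ∣ i ∣ t
    go : d ∣ t → _
    go (ℕ∣.divides q t≡qd) with ∃-prime∣ q {{q≢0}} q≢1
      where
      q≢0 : NonZero q
      q≢0 = ℕ.≢-nonZero λ q≡0 → ℕ.≢-nonZero⁻¹ t (trans t≡qd (cong (ℕ._* d) q≡0))
      q≢1 : q ≢ 1
      q≢1 q≡1 = i≢0 (∣⇒≡0 (subst (_∣ ∣ i ∣)
        (sym (trans t≡qd (trans (cong (ℕ._* d) q≡1) (ℕₚ.*-identityˡ d)))) (gcd[m,n]∣m ∣ i ∣ t)))
    ... | p′ , pr , ℕ∣.divides e q≡ep with prime∣t⇒p F pr
            (subst (p′ ∣_) (sym t≡qd) (ℕ∣.∣m⇒∣m*n d (ℕ∣.divides e q≡ep)))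
    -- Matching on `refl` replaces `p j` by the prime `p′` found above, so that the cofactor `e` is
    -- also the one for `p j`.
    ... | j , refl = j , subst S (trans (sym (ℤₚ.pos-* e d)) (cong +_ (sym t/p≡))) (*∈ (+ e) (gcd∈ s))
      where
      instance _ = prime⇒nonZero pr
      open PrimeFactorization F using (p)
      t≡ : t ≡ e ℕ.* d ℕ.* p j
      t≡ = trans t≡qd (trans (cong (ℕ._* d) q≡ep) (trans (ℕₚ.*-assoc e (p j) d)
             (trans (cong (e ℕ.*_) (ℕₚ.*-comm (p j) d)) (sym (ℕₚ.*-assoc e d (p j))))))
      t/p≡ : t / p j ≡ e ℕ.* d
      t/p≡ = trans (cong (_/ p j) t≡) (m*n/n≡m (e ℕ.* d) (p j))

-- The set P* and the subgroups of Z_t × Z_2.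

module _ {t : ℕ} (F : PrimeFactorization t) {A : Set} (f : ℕ → ℕ → A) where

  P₀*-even : 2 ∣ t → P₀* F f ≡ f 0 1 ∷ f (t / 2) 1 ∷ []
  P₀*-even 2∣t = cong (λ b → if b then f 0 1 ∷ f (t / 2) 1 ∷ [] else f 0 1 ∷ []) (dec-true (2 ∣? t) 2∣t)

  P₀*-odd : ¬ 2 ∣ t → P₀* F f ≡ [ f 0 1 ]
  P₀*-odd 2∤t = cong (λ b → if b then f 0 1 ∷ f (t / 2) 1 ∷ [] else f 0 1 ∷ []) (dec-false (2 ∣? t) 2∤t)

module _ {t : ℕ} .{{_ : NonZero t}} (F : PrimeFactorization t) {A : Set} (f : ℕ → ℕ → A) (Q : Pred A 0ℓ) where
  open PrimeFactorization F
  open Group (Z t ×ᴳ Z 2) using (_≈_; ε)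

  -- If the exponent of σ is even, the element is a nontrivial rotation and `prime-quotient∈`
  -- applies. If it is odd, either i ≡ 0 and the element is σ itself, or the square is the pure
  -- rotation by 2i. A nontrivial square is handled as before; a trivial one forces t even and i ≡
  -- t/2, the second element of `P₀*`.
  P*-meets : ∀ {S x} → IsSubgroup (Z t ×ᴳ Z 2) S → S x → ¬ x ≈ ε →
             (∀ i j → S (+ i , + j) → Q (f i j)) → Any Q (P* F f)
  P*-meets {S} {i , j} S-subgroup s x≉ε S⇒Q = go (parity j)
    where
    open IsSubgroup S-subgroup
    S₀-subgroup : IsSubgroup (Z t) (λ i → S (i , 0ℤ))
    S₀-subgroup = record
      { resp = λ eq → resp (eq , ≡⇒≡mod refl)
      ; ε∈   = ε∈
      ; ∙∈   = ∙∈
      ; ⁻¹∈  = ⁻¹∈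
      }

    rotation : ∀ {i} → S (i , 0ℤ) → ¬ i ≡ 0ℤ ⟨mod t ⟩ → Any Q (P* F f)
    rotation s i≢0 = let k , s′ = prime-quotient∈ S₀-subgroup F s i≢0 in
      Anyₚ.++⁺ʳ (P₀* F f) (Anyₚ.tabulate⁺ k (S⇒Q _ 0 s′))

    σ∈P₀* : S (0ℤ , + 1) → Any Q (P₀* F f)
    σ∈P₀* s with 2 ∣? t
    ... | yes 2∣t = subst (Any Q) (sym (P₀*-even F f 2∣t)) (here (S⇒Q 0 1 s))
    ... | no 2∤t  = subst (Any Q) (sym (P₀*-odd F f 2∤t)) (here (S⇒Q 0 1 s))

    halfturn : 2 ∣ t → S (+ (t / 2) , + 1) → Any Q (P₀* F f)
    halfturn 2∣t s = subst (Any Q) (sym (P₀*-even F f 2∣t)) (there (here (S⇒Q (t / 2) 1 s)))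

    go : Parity j → Any Q (P* F f)
    go (even q eq) = rotation (resp (≡⇒≡mod refl , j≡0) s) (λ i≡0 → x≉ε (i≡0 , j≡0))
      where
      j≡0 : j ≡ 0ℤ ⟨mod 2 ⟩
      j≡0 = ≡+*⇒≡mod q (trans eq (sym (ℤₚ.+-identityˡ _)))
    go (odd q eq) with i ≡? 0ℤ ⟨mod t ⟩
    ... | yes i≡0 = Anyₚ.++⁺ˡ (σ∈P₀* (resp (i≡0 , ≡+*⇒≡mod q eq) s))
    ... | no i≢0 with (i ℤ.+ i) ≡? 0ℤ ⟨mod t ⟩
    ...   | no 2i≢0 = rotation (resp (≡⇒≡mod refl , ≡+*⇒≡mod j (lemma j)) (∙∈ s s)) 2i≢0
      where
      lemma : ∀ j → j ℤ.+ j ≡ 0ℤ ℤ.+ j * + 2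
      lemma = solve-∀
    ...   | yes 2i≡0 = let 2∣t , i≡t/2 = double≡0 2i≡0 i≢0 in
      Anyₚ.++⁺ˡ (halfturn 2∣t (resp (i≡t/2 , ≡+*⇒≡mod q eq) s))

  -- The members of `P₀*` have σ-exponent 1, and no `t / p k` is divisible by `t`. The predicate `Q`
  -- is arbitrary because the lemma serves twice: to separate P* from the identity and to separate
  -- it from a reflection.
  P*-nontrivial : (∀ i j → ¬ (+ i , + j) ≈ ε → Q (f i j)) → All Q (P* F f)
  P*-nontrivial ≉ε⇒Q = Allₚ.++⁺ P₀*-nontrivial (Allₚ.tabulate⁺ λ k →
    let instance _ = prime⇒nonZero (p-prime k) in
    ≉ε⇒Q (t / p k) 0 λ (eq , _) →
      ∤quotient (ℕ.nonTrivial⇒n>1 (p k) {{prime⇒nonTrivial (p-prime k)}}) (p∣t F k) (≡0⇒∣ eq))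
    where
    1≢0 : ¬ + 1 ≡ 0ℤ ⟨mod 2 ⟩
    1≢0 eq with () ← ℕ∣.∣1⇒≡1 (≡0⇒∣ eq)
    P₀*-nontrivial : All Q (P₀* F f)
    P₀*-nontrivial with 2 ∣? t
    ... | yes 2∣t = subst (All Q) (sym (P₀*-even F f 2∣t))
      (≉ε⇒Q 0 1 (λ (_ , eq) → 1≢0 eq) ∷ ≉ε⇒Q (t / 2) 1 (λ (_ , eq) → 1≢0 eq) ∷ [])
    ... | no 2∤t  = subst (All Q) (sym (P₀*-odd F f 2∤t)) (≉ε⇒Q 0 1 (λ (_ , eq) → 1≢0 eq) ∷ [])

-- Indicator functions and finite sums.

𝟙 : {X : Set} → Dec X → ℤ
𝟙 d = if does d then 1ℤ else 0ℤ

module _ {X : Set} where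

  𝟙-true : (d : Dec X) → X → 𝟙 d ≡ 1ℤ
  𝟙-true d x rewrite dec-true d x = refl

  𝟙-false : (d : Dec X) → ¬ X → 𝟙 d ≡ 0ℤ
  𝟙-false d ¬x rewrite dec-false d ¬x = refl

𝟙-cong : {X Y : Set} → X ⇔ Y → (d : Dec X) (e : Dec Y) → 𝟙 d ≡ 𝟙 e
𝟙-cong X⇔Y (yes x) e = sym (𝟙-true e (Equivalence.to X⇔Y x))
𝟙-cong X⇔Y (no ¬x) e = sym (𝟙-false e (¬x ∘ Equivalence.from X⇔Y))

𝟙-× : {X Y : Set} (d : Dec X) (e : Dec Y) → 𝟙 (d ×-dec e) ≡ 𝟙 d * 𝟙 e
𝟙-× (yes _) e = sym (ℤₚ.*-identityˡ (𝟙 e))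
𝟙-× (no _)  e = refl

module _ {A : Set} where

  ∑-cong : ∀ (xs : List A) {f g} → (∀ x → f x ≡ g x) → ∑ xs f ≡ ∑ xs g
  ∑-cong []       eq = refl
  ∑-cong (x ∷ xs) eq = cong₂ ℤ._+_ (eq x) (∑-cong xs eq)

  ∑-zero : ∀ (xs : List A) {f} → (∀ x → f x ≡ 0ℤ) → ∑ xs f ≡ 0ℤ
  ∑-zero []       eq = refl
  ∑-zero (x ∷ xs) eq = cong₂ ℤ._+_ (eq x) (∑-zero xs eq)

  ∑-++ : ∀ (xs ys : List A) f → ∑ (xs ++ ys) f ≡ ∑ xs f ℤ.+ ∑ ys f
  ∑-++ []       ys f = sym (ℤₚ.+-identityˡ _)
  ∑-++ (x ∷ xs) ys f = trans (cong (ℤ._+_ (f x)) (∑-++ xs ys f)) (sym (ℤₚ.+-assoc (f x) (∑ xs f) (∑ ys f)))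

  ∑-map : ∀ {B : Set} (g : B → A) (ys : List B) f → ∑ (map g ys) f ≡ ∑ ys (f ∘ g)
  ∑-map g []       f = refl
  ∑-map g (y ∷ ys) f = cong (ℤ._+_ (f (g y))) (∑-map g ys f)

  ∑-+ : ∀ (xs : List A) f g → (∑[ x ∈ xs ] (f x ℤ.+ g x)) ≡ ∑ xs f ℤ.+ ∑ xs g
  ∑-+ []       f g = refl
  ∑-+ (x ∷ xs) f g = trans (cong (ℤ._+_ (f x ℤ.+ g x)) (∑-+ xs f g)) (lemma (f x) (g x) (∑ xs f) (∑ xs g))
    where
    lemma : ∀ a b c d → (a ℤ.+ b) ℤ.+ (c ℤ.+ d) ≡ (a ℤ.+ c) ℤ.+ (b ℤ.+ d)
    lemma = solve-∀

  ∑-* : ∀ c (xs : List A) f → (∑[ x ∈ xs ] c * f x) ≡ c * ∑ xs f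
  ∑-* c []       f = sym (ℤₚ.*-zeroʳ c)
  ∑-* c (x ∷ xs) f = trans (cong (ℤ._+_ (c * f x)) (∑-* c xs f)) (sym (ℤₚ.*-distribˡ-+ c (f x) (∑ xs f)))

  ∑-- : ∀ (xs : List A) f g → (∑[ x ∈ xs ] (f x - g x)) ≡ ∑ xs f - ∑ xs g
  ∑-- []       f g = refl
  ∑-- (x ∷ xs) f g = trans (cong (ℤ._+_ (f x - g x)) (∑-- xs f g)) (lemma (f x) (g x) (∑ xs f) (∑ xs g))
    where
    lemma : ∀ a b c d → (a - b) ℤ.+ (c - d) ≡ (a ℤ.+ c) - (b ℤ.+ d)
    lemma = solve-∀

∑-swap : ∀ {A B : Set} (xs : List A) (ys : List B) (f : A → B → ℤ) →
         (∑[ x ∈ xs ] ∑[ y ∈ ys ] f x y) ≡ (∑[ y ∈ ys ] ∑[ x ∈ xs ] f x y)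
∑-swap []       ys f = sym (∑-zero ys (λ _ → refl))
∑-swap (x ∷ xs) ys f = trans (cong (ℤ._+_ (∑ ys (f x))) (∑-swap xs ys f))
  (sym (∑-+ ys (f x) (λ y → ∑[ x ∈ xs ] f x y)))

module _ {A : Set} where

  ∑-single : ∀ {xs : List A} {x} f → Unique xs → x ∈ xs →
             (∀ {y} → y ∈ xs → x ≢ y → f y ≡ 0ℤ) → ∑ xs f ≡ f x
  ∑-single {x ∷ xs} f (x∉xs ∷ _) (here refl) f≡0 = trans
    (cong (ℤ._+_ (f x)) (vanish xs x∉xs (f≡0 ∘ there))) (ℤₚ.+-identityʳ (f x))
    where
    vanish : ∀ ys → All (x ≢_) ys → (∀ {y} → y ∈ ys → x ≢ y → f y ≡ 0ℤ) → ∑ ys f ≡ 0ℤ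
    vanish []       []         _    = refl
    vanish (y ∷ ys) (x≢y ∷ ≢s) f≡0 = cong₂ ℤ._+_ (f≡0 (here refl) x≢y) (vanish ys ≢s (f≡0 ∘ there))
  ∑-single {y ∷ ys} {x} f (y∉ys ∷ unique) (there x∈ys) f≡0 = trans
    (cong₂ ℤ._+_ (f≡0 (here refl) (λ eq → All.lookup y∉ys x∈ys (sym eq)))
                 (∑-single f unique x∈ys (f≡0 ∘ there)))
    (ℤₚ.+-identityˡ (f x))

  length-filter≡∑ : ∀ {Q : Pred A 0ℓ} (Q? : Decidable Q) xs →
                    + length (filter Q? xs) ≡ (∑[ x ∈ xs ] 𝟙 (Q? x))
  length-filter≡∑ Q? []       = refl
  length-filter≡∑ Q? (x ∷ xs) with Q? x
  ... | yes _ = trans (ℤₚ.pos-+ 1 (length (filter Q? xs))) (cong (ℤ._+_ 1ℤ) (length-filter≡∑ Q? xs))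
  ... | no _  = trans (length-filter≡∑ Q? xs) (sym (ℤₚ.+-identityˡ _))

  sublists-All : ∀ {Q : Pred A 0ℓ} {xs} → All Q xs → All (All Q) (sublists xs)
  sublists-All []         = [] ∷ []
  sublists-All (qx ∷ qxs) = Allₚ.++⁺ (Allₚ.map⁺ (All.map (qx ∷_) (sublists-All qxs))) (sublists-All qxs)

  -- Inclusion-exclusion over sublists.

  module _ {Q : Pred A 0ℓ} (Q? : Decidable Q) where

    𝟙-¬Any-∷ : ∀ x xs → 𝟙 (¬? (Any.any? Q? (x ∷ xs))) ≡ (1ℤ - 𝟙 (Q? x)) * 𝟙 (¬? (Any.any? Q? xs))
    𝟙-¬Any-∷ x xs with Q? x
    ... | yes _ = refl
    ... | no _  with Any.any? Q? xs
    ...   | yes _ = refl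
    ...   | no _  = refl

    𝟙-All-∷ : ∀ x xs → 𝟙 (All.all? Q? (x ∷ xs)) ≡ 𝟙 (Q? x) * 𝟙 (All.all? Q? xs)
    𝟙-All-∷ x xs with Q? x
    ... | no _  = refl
    ... | yes _ with All.all? Q? xs
    ...   | yes _ = refl
    ...   | no _  = refl

    -- The left side is the expansion of the product of the factors 1 - 𝟙(Q x): sublists containing
    -- the head contribute -𝟙(Q x) times the sum for the tail, the others that sum itself.
    inclusion-exclusion : ∀ xs →
      (∑[ P ∈ sublists xs ] (-1ℤ ^ length P * 𝟙 (All.all? Q? P))) ≡ 𝟙 (¬? (Any.any? Q? xs))
    inclusion-exclusion []       = refl
    inclusion-exclusion (x ∷ xs) = begin
      ∑ (map (x ∷_) (sublists xs) ++ sublists xs) term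
        ≡⟨ ∑-++ (map (x ∷_) (sublists xs)) (sublists xs) term ⟩
      ∑ (map (x ∷_) (sublists xs)) term ℤ.+ ∑ (sublists xs) term
        ≡⟨ cong (ℤ._+ ∑ (sublists xs) term) (∑-map (x ∷_) (sublists xs) term) ⟩
      ∑ (sublists xs) (term ∘ (x ∷_)) ℤ.+ ∑ (sublists xs) term
        ≡⟨ cong (ℤ._+ ∑ (sublists xs) term) (∑-cong (sublists xs) λ P →
             trans (cong (-1ℤ * -1ℤ ^ length P *_) (𝟙-All-∷ x P))
                   (lemma₁ (-1ℤ ^ length P) (𝟙 (Q? x)) (𝟙 (All.all? Q? P)))) ⟩
      (∑[ P ∈ sublists xs ] ℤ.- 𝟙 (Q? x) * term P) ℤ.+ ∑ (sublists xs) term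
        ≡⟨ cong (ℤ._+ ∑ (sublists xs) term) (∑-* (ℤ.- 𝟙 (Q? x)) (sublists xs) term) ⟩
      ℤ.- 𝟙 (Q? x) * ∑ (sublists xs) term ℤ.+ ∑ (sublists xs) term
        ≡⟨ lemma₂ (𝟙 (Q? x)) (∑ (sublists xs) term) ⟩
      (1ℤ - 𝟙 (Q? x)) * ∑ (sublists xs) term
        ≡⟨ cong ((1ℤ - 𝟙 (Q? x)) *_) (inclusion-exclusion xs) ⟩
      (1ℤ - 𝟙 (Q? x)) * 𝟙 (¬? (Any.any? Q? xs))
        ≡⟨ 𝟙-¬Any-∷ x xs ⟨
      𝟙 (¬? (Any.any? Q? (x ∷ xs))) ∎
      where
      term : List A → ℤ
      term P = -1ℤ ^ length P * 𝟙 (All.all? Q? P)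
      lemma₁ : ∀ s a b → -1ℤ * s * (a * b) ≡ ℤ.- a * (s * b)
      lemma₁ = solve-∀
      lemma₂ : ∀ a s → ℤ.- a * s ℤ.+ s ≡ (1ℤ - a) * s
      lemma₂ = solve-∀

#labelings≡∑ : ∀ {n k} {Q : Pred (Labeling n k) 0ℓ} (Q? : Decidable Q) →
               + #labelings Q? ≡ (∑[ l ∈ allFin (k ℕ.^ n) ] 𝟙 (Q? (finToFun l)))
#labelings≡∑ {n} {k} Q? = length-filter≡∑ (Q? ∘ finToFun) (allFin (k ℕ.^ n))

-- Exchanging the two summations reduces an identity between signed counts to one for each single
-- labeling.
∑-#labelings : ∀ {n k} {A : Set} (xs : List A) (c : A → ℤ)
  {Q : A → Pred (Labeling n k) 0ℓ} (Q? : ∀ x → Decidable (Q x)) →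
  (∑[ x ∈ xs ] (c x * + #labelings (Q? x))) ≡
  (∑[ l ∈ allFin (k ℕ.^ n) ] ∑[ x ∈ xs ] (c x * 𝟙 (Q? x (finToFun l))))
∑-#labelings {n} {k} xs c Q? = trans
  (∑-cong xs λ x → trans (cong (c x *_) (#labelings≡∑ (Q? x)))
    (sym (∑-* (c x) (allFin (k ℕ.^ n)) (λ l → 𝟙 (Q? x (finToFun l))))))
  (∑-swap xs (allFin (k ℕ.^ n)) (λ x l → c x * 𝟙 (Q? x (finToFun l))))

-- Subsets of automorphisms and the labelings they preserve.

module _ {n : ℕ} (G : Graph n) where
  private
    infix 4 _≈_
    _≈_ = _≈ᴬ_ G
    module Morphisms (K : Group 0ℓ 0ℓ) = GroupMorphisms (Group.rawGroup K) (Group.rawGroup (Aut G))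
    open Morphisms using () renaming (IsGroupHomomorphism to Hom; IsGroupMonomorphism to Mono)

  -- Since `g` differs from every member of `B`, the sublists of the deduplicated list split into
  -- those headed by `g`, which all contain it, and those drawn from `B`, none of which does.
  between-∷ : ∀ g B → All (λ π → ¬ g ≈ π) B → between G [ g ] (g ∷ B) ≡ map (g ∷_) (subsets G B)
  between-∷ g B g∉B = begin
    filter [g]⊆? (map (g ∷_) (sublists R) ++ sublists R)
      ≡⟨ filter-++ [g]⊆? (map (g ∷_) (sublists R)) (sublists R) ⟩
    filter [g]⊆? (map (g ∷_) (sublists R)) ++ filter [g]⊆? (sublists R)
      ≡⟨ cong₂ _++_
           (filter-all [g]⊆? (Allₚ.map⁺ (All.universal (λ P {π} → λ { (here eq) → here eq }) (sublists R))))
           (filter-none [g]⊆? (All.map (λ g∉P [g]⊆P → Allₚ.All¬⇒¬Any {P = g ≈_} g∉P ([g]⊆P {g} (here λ v → refl)))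
             (sublists-All (subst (All (λ π → ¬ g ≈ π)) (sym R≡) g∉dedup)))) ⟩
    map (g ∷_) (sublists R) ++ []
      ≡⟨ ++-identityʳ _ ⟩
    map (g ∷_) (sublists R)
      ≡⟨ cong (map (g ∷_) ∘ sublists) R≡ ⟩
    map (g ∷_) (subsets G B) ∎
    where
    open Subset (Aut-decSetoid G) using (_⊆?_)
    [g]⊆? = [ g ] ⊆?_
    -- This is the tail that `deduplicate` computes for `g ∷ B`; with no copy of `g` in `B` the
    -- filter removes nothing.
    R = filter (¬? ∘ _≈ᴬ?_ G g) (deduplicate (_≈ᴬ?_ G) B)
    g∉dedup : All (λ π → ¬ g ≈ π) (deduplicate (_≈ᴬ?_ G) B)
    g∉dedup = Allₚ.deduplicate⁺ (_≈ᴬ?_ G) g∉B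
    R≡ : R ≡ deduplicate (_≈ᴬ?_ G) B
    R≡ = filter-all (¬? ∘ _≈ᴬ?_ G g) g∉dedup

  module _ {k : ℕ} (φ : Labeling n k) where
    private
      Pres : Automorphism G → Set
      Pres π = Preserves G π φ
      pres? : Decidable Pres
      pres? π = preserves? G π φ

    NonePreserves : List (Automorphism G) → Set
    NonePreserves B = ¬ Any Pres B

    nonePreserves? : ∀ B → Dec (NonePreserves B)
    nonePreserves? B = ¬? (Any.any? pres? B)

    -- Preservation respects equality of automorphisms, so removing repetitions does not affect
    -- whether some member of `B` preserves φ.
    subsets-inclusion-exclusion : ∀ B →
      (∑[ P ∈ subsets G B ] (-1ℤ ^ length P * 𝟙 (preservedByAll? G P φ))) ≡ 𝟙 (nonePreserves? B)
    subsets-inclusion-exclusion B = trans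
      (inclusion-exclusion pres? (deduplicate (_≈ᴬ?_ G) B))
      (𝟙-cong (mk⇔ (λ none any → none (Anyₚ.deduplicate⁺ (_≈ᴬ?_ G) {xs = B}
                     (λ {π} {π′} eq → Preserves-resp G φ π π′ (λ v → sym (eq v))) any))
                   (λ none any → none (Anyₚ.deduplicate⁻ (_≈ᴬ?_ G) any)))
              (nonePreserves? (deduplicate (_≈ᴬ?_ G) B)) (nonePreserves? B))

    -- Each `P` here is `g ∷ P′` with `P′` a subset of `B`, so `length P ∸ 1` is the length of `P′`
    -- and nothing is truncated. The factor 𝟙(g preserves φ) is common to all terms.
    between-inclusion-exclusion : ∀ g B → All (λ π → ¬ g ≈ π) B →
      (∑[ P ∈ between G [ g ] (g ∷ B) ] (-1ℤ ^ (length P ∸ 1) * 𝟙 (preservedByAll? G P φ))) ≡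
      𝟙 (pres? g ×-dec nonePreserves? B)
    between-inclusion-exclusion g B g∉B = begin
      ∑ (between G [ g ] (g ∷ B)) term
        ≡⟨ cong (λ Ps → ∑ Ps term) (between-∷ g B g∉B) ⟩
      ∑ (map (g ∷_) (subsets G B)) term
        ≡⟨ ∑-map (g ∷_) (subsets G B) term ⟩
      (∑[ P ∈ subsets G B ] (-1ℤ ^ length P * 𝟙 (preservedByAll? G (g ∷ P) φ)))
        ≡⟨ ∑-cong (subsets G B) (λ P → trans (cong (-1ℤ ^ length P *_) (𝟙-All-∷ pres? g P))
             (lemma (-1ℤ ^ length P) (𝟙 (pres? g)) (𝟙 (preservedByAll? G P φ)))) ⟩
      (∑[ P ∈ subsets G B ] (𝟙 (pres? g) * (-1ℤ ^ length P * 𝟙 (preservedByAll? G P φ))))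
        ≡⟨ ∑-* (𝟙 (pres? g)) (subsets G B) _ ⟩
      𝟙 (pres? g) * (∑[ P ∈ subsets G B ] (-1ℤ ^ length P * 𝟙 (preservedByAll? G P φ)))
        ≡⟨ cong (𝟙 (pres? g) *_) (subsets-inclusion-exclusion B) ⟩
      𝟙 (pres? g) * 𝟙 (nonePreserves? B)
        ≡⟨ 𝟙-× (pres? g) (nonePreserves? B) ⟨
      𝟙 (pres? g ×-dec nonePreserves? B) ∎
      where
      term : List (Automorphism G) → ℤ
      term P = -1ℤ ^ (length P ∸ 1) * 𝟙 (preservedByAll? G P φ)
      lemma : ∀ s a b → s * (a * b) ≡ a * (s * b)
      lemma = solve-∀

    -- The source group and the homomorphism are left general: the lemma is applied to the rotations
    -- and to the whole dihedral product.
    stabilizer-isSubgroup : ∀ (K : Group 0ℓ 0ℓ) h → Hom K h → IsSubgroup K (λ x → Pres (h x))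
    stabilizer-isSubgroup K h hom = record
      { resp = λ {x} {y} x≈y → Preserves-resp G φ (h x) (h y) (⟦⟧-cong x≈y)
      ; ε∈   = Preserves-resp G φ (idᴬ G) (h K.ε) (λ v → sym (ε-homo v)) (λ v → refl)
      ; ∙∈   = λ {x} {y} px py → Preserves-resp G φ (_∘ᴬ_ G (h x) (h y)) (h (x K.∙ y)) (λ v → sym (homo x y v))
                 (λ v → trans (px (h y $ v)) (py v))
      ; ⁻¹∈  = λ {x} px → Preserves-resp G φ (_⁻¹ᴬ G (h x)) (h (x K.⁻¹)) (λ v → sym (⁻¹-homo x v))
                 (λ v → trans (sym (px (_⁻¹ᴬ G (h x) $ v))) (cong φ (Perm.inverseʳ (Automorphism.perm (h x)))))
      }
      where
      module K = Group K
      open Automorphism using (_$_)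
      open GroupMorphisms.IsGroupHomomorphism hom

    module _ {t : ℕ} .{{_ : NonZero t}} (F : PrimeFactorization t) where
      private module R = Group (Z t ×ᴳ Z 2)

      -- Only a monomorphism is assumed, so that the module covers both the case where Z_t × Z_2 is
      -- the whole automorphism group and the case where it is the rotation part of D_t × Z_2.
      module Rotations (h : ℤ × ℤ → Automorphism G) (mono : Mono (Z t ×ᴳ Z 2) h) where
        open GroupMorphisms.IsGroupMonomorphism mono

        P⋆ : List (Automorphism G)
        P⋆ = P* F (λ i j → h (+ i , + j))

        preserving⇒trivial : NonePreserves P⋆ → ∀ x → Pres (h x) → x R.≈ R.ε
        preserving⇒trivial none x@(i , j) px with (i ≡? 0ℤ ⟨mod t ⟩) ×-dec (j ≡? 0ℤ ⟨mod 2 ⟩)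
        ... | yes x≈ε = x≈ε
        ... | no x≉ε  = contradiction
          (P*-meets F (λ i j → h (+ i , + j)) Pres
            (stabilizer-isSubgroup (Z t ×ᴳ Z 2) h isGroupHomomorphism) px x≉ε (λ i j p → p))
          none

        P⋆-nontrivial : All (λ π → ¬ π ≈ idᴬ G) P⋆
        P⋆-nontrivial = P*-nontrivial F (λ i j → h (+ i , + j)) (λ π → ¬ π ≈ idᴬ G) λ i j x≉ε h≈id →
          x≉ε (injective {+ i , + j} {R.ε} (λ v → trans (h≈id v) (sym (ε-homo v))))

        distinguishing⇒none : Distinguishing G φ → NonePreserves P⋆
        distinguishing⇒none dist any =
          Allₚ.All¬⇒¬Any P⋆-nontrivial (Any.map (λ {π} → dist π) any)

      -- The cyclic case for one labeling.

      module CyclicCase (ψ : (Z t ×ᴳ Z 2) ≅ Aut G) where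
        open _≅_ ψ
        open GroupMorphisms.IsGroupIsomorphism isGroupIsomorphism
        open Rotations ⟦_⟧ isGroupMonomorphism

        distinguishing⇔none : Distinguishing G φ ⇔ NonePreserves P⋆
        distinguishing⇔none = mk⇔ distinguishing⇒none λ none π pπ →
          let x , x↦ = surjective π
              x↦π = x↦ R.refl
              x≈ε = preserving⇒trivial none x (Preserves-resp G φ π ⟦ x ⟧ (λ v → sym (x↦π v)) pπ)
          in λ v → trans (sym (x↦π v)) (trans (⟦⟧-cong x≈ε v) (ε-homo v))

      -- The dihedral case for one labeling.

      module DihedralCase (ψ : (D t ×ᴳ Z 2) ≅ Aut G) where
        open _≅_ ψ
        open GroupMorphisms.IsGroupIsomorphism isGroupIsomorphism
        private module K = Group (D t ×ᴳ Z 2)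

        rotation : ℤ × ℤ → Automorphism G
        rotation (i , j) = ⟦ ρ^ i , j ⟧

        rotation-isGroupMonomorphism : Mono (Z t ×ᴳ Z 2) rotation
        rotation-isGroupMonomorphism = record
          { isGroupHomomorphism = record
            { isMonoidHomomorphism = record
              { isMagmaHomomorphism = record
                { isRelHomomorphism = record { cong = λ (p , q) → ⟦⟧-cong (ρ^-cong p , q) }
                ; homo = λ (i , j) (i′ , j′) → ∙-homo (ρ^ i , j) (ρ^ i′ , j′)
                }
              ; ε-homo = ε-homo
              }
            ; ⁻¹-homo = λ (i , j) → ⁻¹-homo (ρ^ i , j)
            }
          ; injective = λ {x} {y} eq → ρ-injective (injective {ρ^ proj₁ x , proj₂ x} {ρ^ proj₁ y , proj₂ y} eq)
          }
          where
          ρ-injective : ∀ {i j i′ j′} → (ρ^ i , j) K.≈ (ρ^ i′ , j′) → (i , j) R.≈ (i′ , j′)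
          ρ-injective (ρ^-cong p , q) = p , q

        open Rotations rotation rotation-isGroupMonomorphism
        open IsSubgroup (stabilizer-isSubgroup (D t ×ᴳ Z 2) ⟦_⟧ isGroupHomomorphism)

        reflection : ℕ → ℕ → Automorphism G
        reflection i b = ⟦ τρ^ (+ i) , + b ⟧

        reflection≉rotation : ∀ i b x → ¬ reflection i b ≈ rotation x
        reflection≉rotation i b x eq with () , _ ← injective {τρ^ (+ i) , + b} {ρ^ proj₁ x , proj₂ x} eq

        reflection∉P⋆ : ∀ i b → All (λ π → ¬ reflection i b ≈ π) P⋆
        reflection∉P⋆ i b = P*-nontrivial F (λ j c → rotation (+ j , + c)) (λ π → ¬ reflection i b ≈ π)
          λ j c _ → reflection≉rotation i b (+ j , + c)

        -- The product of the two reflections is a rotation preserving φ, hence trivial.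
        preserving-reflections-equal : NonePreserves P⋆ → ∀ i b j c →
          Pres ⟦ τρ^ i , b ⟧ → Pres ⟦ τρ^ j , c ⟧ → (j , c) R.≈ (i , b)
        preserving-reflections-equal none i b j c p q =
          let i≡j , b≡c = preserving⇒trivial none (ℤ.- i ℤ.+ j , ℤ.- b ℤ.+ c)
                -- The product has σ-exponent b + c. It is rewritten as -b + c, which differs by 2b,
                -- so that both coordinates have the shape required by `-≡0⇒≡mod`.
                (resp {τρ^ i · τρ^ j , b ℤ.+ c} {ρ^ (ℤ.- i ℤ.+ j) , ℤ.- b ℤ.+ c}
                  (ρ^-cong (≡⇒≡mod refl) , ≡+*⇒≡mod b (lemma b c)) (∙∈ p q))
          in -≡0⇒≡mod i≡j , -≡0⇒≡mod b≡c
          where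
          lemma : ∀ b c → b ℤ.+ c ≡ (ℤ.- b ℤ.+ c) ℤ.+ b * + 2
          lemma = solve-∀

        exactly : ℕ → ℕ → List (Automorphism G)
        exactly i b = ⟦ ρ^ 0ℤ , 0ℤ ⟧ ∷ reflection i b ∷ []

        -- Forwards, members of P* are neither the identity nor the reflection, so none preserves φ.
        -- Backwards, a preserving rotation is trivial and a preserving reflection coincides with
        -- the given one.
        exactly⇔ : ∀ i b → PreservedExactlyBy G (exactly i b) φ ⇔ (Pres (reflection i b) × NonePreserves P⋆)
        exactly⇔ i b = mk⇔ to from
          where
          g = reflection i b
          to : PreservedExactlyBy G (exactly i b) φ → Pres g × NonePreserves P⋆
          to exact = Equivalence.from (exact g) (there (here λ v → refl)) ,
            Allₚ.All¬⇒¬Any {P = Pres} (All.zipWith (λ {π} → excluded π) (P⋆-nontrivial , reflection∉P⋆ i b))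
            where
            excluded : ∀ π → (¬ π ≈ idᴬ G) × (¬ g ≈ π) → ¬ Pres π
            excluded π (π≉id , g≉π) pπ with Equivalence.to (exact π) pπ
            ... | here π≈         = π≉id λ v → trans (π≈ v) (ε-homo v)
            ... | there (here π≈) = g≉π λ v → sym (π≈ v)
          from : Pres g × NonePreserves P⋆ → PreservedExactlyBy G (exactly i b) φ
          from (pg , none) π with surjective π
          ... | x , x↦ = mk⇔
            (λ pπ → member x (x↦ K.refl) (Preserves-resp G φ π ⟦ x ⟧ (λ v → sym (x↦ K.refl v)) pπ))
            λ { (here π≈)         → Preserves-resp G φ ⟦ K.ε ⟧ π (λ v → sym (π≈ v)) ε∈
              ; (there (here π≈)) → Preserves-resp G φ g π (λ v → sym (π≈ v)) pg }
            where
            member : ∀ x → ⟦ x ⟧ ≈ π → Pres ⟦ x ⟧ → Any (π ≈_) (exactly i b)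
            member (ρ^ j , c) x↦π px =
              let j≡0 , c≡0 = preserving⇒trivial none (j , c) px
              in here λ v → trans (sym (x↦π v)) (⟦⟧-cong (ρ^-cong j≡0 , c≡0) v)
            member (τρ^ j , c) x↦π px =
              let j≡i , c≡b = preserving-reflections-equal none (+ i) (+ b) j c pg px
              in there (here λ v → trans (sym (x↦π v)) (⟦⟧-cong (τρ^-cong j≡i , c≡b) v))

        -- The bounded ranges make this decidable and supply indices within the range of the double
        -- sum.
        SomeReflection : Set
        SomeReflection = Any (λ b → Any (λ i → Pres (reflection i b)) (upTo t)) (upTo 2)

        someReflection? : Dec SomeReflection
        someReflection? = Any.any? (λ b → Any.any? (λ i → pres? (reflection i b)) (upTo t)) (upTo 2)

        someReflection⁺ : ∀ i b → Pres ⟦ τρ^ i , b ⟧ → SomeReflection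
        someReflection⁺ i b p =
          -- Arbitrary integer exponents are replaced by their remainders, which name the same
          -- reflection.
          lose (∈-upTo⁺ (n%ℕd<d b 2)) (lose (∈-upTo⁺ (n%ℕd<d i t))
            (resp {τρ^ i , b} {τρ^ (+ (i %ℕ t)) , + (b %ℕ 2)} (τρ^-cong (≡mod-%ℕ i) , ≡mod-%ℕ b) p))

        distinguishing : NonePreserves P⋆ → ¬ SomeReflection → Distinguishing G φ
        distinguishing none ¬refl π pπ with surjective π
        ... | x , x↦ = go x (x↦ K.refl) (Preserves-resp G φ π ⟦ x ⟧ (λ v → sym (x↦ K.refl v)) pπ)
          where
          go : ∀ x → ⟦ x ⟧ ≈ π → Pres ⟦ x ⟧ → π ≈ idᴬ G
          go (ρ^ j , c) x↦π px = let j≡0 , c≡0 = preserving⇒trivial none (j , c) px in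
            λ v → trans (sym (x↦π v)) (trans (⟦⟧-cong (ρ^-cong j≡0 , c≡0) v) (ε-homo v))
          go (τρ^ j , c) x↦π px = contradiction (someReflection⁺ j c px) ¬refl

        exactly? : ∀ i b → Dec (PreservedExactlyBy G (exactly i b) φ)
        exactly? i b = preservedExactlyBy? G (exactly i b) φ

        ∑-exactly-zero : (∀ i b → ¬ (Pres (reflection i b) × NonePreserves P⋆)) →
          (∑[ b ∈ upTo 2 ] ∑[ i ∈ upTo t ] 𝟙 (exactly? i b)) ≡ 0ℤ
        ∑-exactly-zero none = ∑-zero (upTo 2) λ b → ∑-zero (upTo t) λ i →
          𝟙-false (exactly? i b) (none i b ∘ Equivalence.to (exactly⇔ i b))

        -- Exactly one term survives: any other index pair contributing 1 would name a preserving
        -- reflection congruent to the given one, and congruent indices in range are equal.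
        ∑-exactly-one : NonePreserves P⋆ → ∀ i b → i ∈ upTo t → b ∈ upTo 2 → Pres (reflection i b) →
          (∑[ b ∈ upTo 2 ] ∑[ i ∈ upTo t ] 𝟙 (exactly? i b)) ≡ 1ℤ
        ∑-exactly-one none i₀ b₀ i₀∈ b₀∈ p₀ = begin
          (∑[ b ∈ upTo 2 ] ∑[ i ∈ upTo t ] 𝟙 (exactly? i b))
            ≡⟨ ∑-single (λ b → ∑[ i ∈ upTo t ] 𝟙 (exactly? i b)) (upTo⁺ 2) b₀∈ (λ {b} b∈ b₀≢b →
                 ∑-zero (upTo t) λ i → 𝟙-false (exactly? i b) λ exact →
                   b₀≢b (≡mod⇒≡ (∈-upTo⁻ b₀∈) (∈-upTo⁻ b∈) (proj₂ (unique i b exact)))) ⟩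
          (∑[ i ∈ upTo t ] 𝟙 (exactly? i b₀))
            ≡⟨ ∑-single (λ i → 𝟙 (exactly? i b₀)) (upTo⁺ t) i₀∈ (λ {i} i∈ i₀≢i →
                 𝟙-false (exactly? i b₀) λ exact →
                   i₀≢i (≡mod⇒≡ (∈-upTo⁻ i₀∈) (∈-upTo⁻ i∈) (proj₁ (unique i b₀ exact)))) ⟩
          𝟙 (exactly? i₀ b₀)
            ≡⟨ 𝟙-true (exactly? i₀ b₀) (Equivalence.from (exactly⇔ i₀ b₀) (p₀ , none)) ⟩
          1ℤ ∎
          where
          unique : ∀ i b → PreservedExactlyBy G (exactly i b) φ → (+ i₀ , + b₀) R.≈ (+ i , + b)
          unique i b exact = preserving-reflections-equal none (+ i) (+ b) (+ i₀) (+ b₀)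
            (proj₁ (Equivalence.to (exactly⇔ i b) exact)) p₀

        -- There are three cases. If a member of P* preserves φ, the identity reads 0 = 0 - 0.
        -- Otherwise it reads 1 = 1 - 0 when no reflection preserves φ, and 0 = 1 - 1 when one does,
        -- since a reflection is not the identity.
        𝟙-distinguishing : (distinguishing? : Dec (Distinguishing G φ)) → 𝟙 distinguishing? ≡
          𝟙 (nonePreserves? P⋆) - (∑[ b ∈ upTo 2 ] ∑[ i ∈ upTo t ] 𝟙 (exactly? i b))
        𝟙-distinguishing dist? = go (nonePreserves? P⋆) someReflection?
          where
          go : (none? : Dec (NonePreserves P⋆)) → Dec SomeReflection →
               𝟙 dist? ≡ 𝟙 none? - (∑[ b ∈ upTo 2 ] ∑[ i ∈ upTo t ] 𝟙 (exactly? i b))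
          go (no ¬none) _ = trans (𝟙-false dist? (¬none ∘ distinguishing⇒none))
            (sym (cong (0ℤ -_) (∑-exactly-zero λ i b (_ , none) → ¬none none)))
          go (yes none) (no ¬some) = trans (𝟙-true dist? (distinguishing none ¬some))
            (sym (cong (1ℤ -_) (∑-exactly-zero λ i b (p , _) → ¬some (someReflection⁺ (+ i) (+ b) p))))
          go (yes none) (yes some) =
            let b , b∈ , some′ = find some
                i , i∈ , p     = find some′
            in trans
              (𝟙-false dist? λ dist → reflection≉rotation i b (0ℤ , 0ℤ)
                λ v → trans (dist (reflection i b) p v) (sym (ε-homo v)))
              (sym (cong (1ℤ -_) (∑-exactly-one none i b i∈ b∈ p)))

  -- Summation over all labelings.

  ∑-subsets-N≥ : ∀ k B → (∑[ P ∈ subsets G B ] (-1ℤ ^ length P * + N≥ G k P)) ≡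
    (∑[ l ∈ allFin (k ℕ.^ n) ] 𝟙 (nonePreserves? {k} (finToFun l) B))
  ∑-subsets-N≥ k B = trans
    (∑-#labelings (subsets G B) (λ P → -1ℤ ^ length P) (preservedByAll? G))
    (∑-cong (allFin (k ℕ.^ n)) λ l → subsets-inclusion-exclusion (finToFun l) B)

theorem4 :
    ∀ {n : ℕ} (G : Graph n) (t : ℕ) .{{_ : NonZero t}} (F : PrimeFactorization t)
      (k : ℕ) .{{_ : NonZero k}} →
    ((ψ : (Z t ×ᴳ Z 2) ≅ Aut G) →
      let π = _≅_.⟦_⟧ ψ
          P⋆ = P* F (λ i j → π (+ i , + j))
      in + L G k ≡ (∑[ P ∈ subsets G P⋆ ] (-1ℤ ^ length P * + N≥ G k P)))
    ×
    ((ψ : (D t ×ᴳ Z 2) ≅ Aut G) →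
      let π = _≅_.⟦_⟧ ψ
          P⋆ = P* F (λ i j → π (ρ^ (+ i) , + j))
          id = π (ρ^ (+ 0) , + 0)
          πτ = λ (i b : ℕ) → π (τρ^ (+ i) , + b)
      in
      (∀ (b : Fin 2) (i : Fin t) →
        + N= G k (id ∷ πτ (toℕ i) (toℕ b) ∷ [])
          ≡ (∑[ P ∈ between G [ πτ (toℕ i) (toℕ b) ] ([ πτ (toℕ i) (toℕ b) ] ++ P⋆) ]
               (-1ℤ ^ (length P ∸ 1) * + N≥ G k P)))
      ×
      (+ L G k
        ≡ (∑[ P ∈ subsets G P⋆ ] (-1ℤ ^ length P * + N≥ G k P))
          - (∑[ b ∈ upTo 2 ] ∑[ i ∈ upTo t ] (+ N= G k (id ∷ πτ i b ∷ [])))))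
theorem4 {n} G t F k = cyclic , λ ψ → dihedral-N= ψ , dihedral-L ψ
  where
  labelings : List (Fin (k ℕ.^ n))
  labelings = allFin (k ℕ.^ n)

  φ : Fin (k ℕ.^ n) → Labeling n k
  φ = finToFun

  cyclic : (ψ : (Z t ×ᴳ Z 2) ≅ Aut G) → let P⋆ = P* F (λ i j → _≅_.⟦_⟧ ψ (+ i , + j)) in
    + L G k ≡ (∑[ P ∈ subsets G P⋆ ] (-1ℤ ^ length P * + N≥ G k P))
  cyclic ψ = begin
    + L G k
      ≡⟨ #labelings≡∑ (distinguishing? G) ⟩
    (∑[ l ∈ labelings ] 𝟙 (distinguishing? G (φ l)))
      ≡⟨ ∑-cong labelings (λ l → 𝟙-cong (CyclicCase.distinguishing⇔none G (φ l) F ψ)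
           (distinguishing? G (φ l)) (nonePreserves? G (φ l) P⋆)) ⟩
    (∑[ l ∈ labelings ] 𝟙 (nonePreserves? G (φ l) P⋆))
      ≡⟨ ∑-subsets-N≥ G k P⋆ ⟨
    (∑[ P ∈ subsets G P⋆ ] (-1ℤ ^ length P * + N≥ G k P)) ∎
    where
    P⋆ = P* F (λ i j → _≅_.⟦_⟧ ψ (+ i , + j))

  module _ (ψ : (D t ×ᴳ Z 2) ≅ Aut G) where
    open _≅_ ψ using (⟦_⟧)
    private
      module C (l : Fin (k ℕ.^ n)) = DihedralCase G (φ l) F ψ

      P⋆ : List (Automorphism G)
      P⋆ = P* F (λ i j → ⟦ ρ^ (+ i) , + j ⟧)

      g : ℕ → ℕ → Automorphism G
      g i b = ⟦ τρ^ (+ i) , + b ⟧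

      exactly : ℕ → ℕ → List (Automorphism G)
      exactly i b = ⟦ ρ^ (+ 0) , + 0 ⟧ ∷ g i b ∷ []

      exactly? : ∀ i b l → Dec (PreservedExactlyBy G (exactly i b) (φ l))
      exactly? i b l = preservedExactlyBy? G (exactly i b) (φ l)

    -- For each labeling both sides equal the indicator that the reflection preserves it and no
    -- member of P* does.
    dihedral-N= : ∀ (b : Fin 2) (i : Fin t) → + N= G k (exactly (toℕ i) (toℕ b)) ≡
      (∑[ P ∈ between G [ g (toℕ i) (toℕ b) ] (g (toℕ i) (toℕ b) ∷ P⋆) ]
        (-1ℤ ^ (length P ∸ 1) * + N≥ G k P))
    dihedral-N= b i = begin
      + N= G k (exactly i′ b′)
        ≡⟨ #labelings≡∑ (preservedExactlyBy? G (exactly i′ b′)) ⟩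
      (∑[ l ∈ labelings ] 𝟙 (exactly? i′ b′ l))
        ≡⟨ ∑-cong labelings (λ l → trans
             (𝟙-cong (C.exactly⇔ l i′ b′) (exactly? i′ b′ l)
               (preserves? G (g i′ b′) (φ l) ×-dec nonePreserves? G (φ l) P⋆))
             (sym (between-inclusion-exclusion G (φ l) (g i′ b′) P⋆ (C.reflection∉P⋆ l i′ b′)))) ⟩
      (∑[ l ∈ labelings ] ∑[ P ∈ Ps ] (-1ℤ ^ (length P ∸ 1) * 𝟙 (preservedByAll? G P (φ l))))
        ≡⟨ ∑-#labelings Ps (λ P → -1ℤ ^ (length P ∸ 1)) (preservedByAll? G) ⟨
      (∑[ P ∈ Ps ] (-1ℤ ^ (length P ∸ 1) * + N≥ G k P)) ∎
      where
      i′ = toℕ i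
      b′ = toℕ b
      Ps = between G [ g i′ b′ ] (g i′ b′ ∷ P⋆)

    -- A variable bound `c` keeps the outer sum from reducing to its two summands; it is used with
    -- `c` equal to 2.
    ∑-N= : ∀ c → (∑[ b ∈ upTo c ] ∑[ i ∈ upTo t ] (+ N= G k (exactly i b))) ≡
      (∑[ l ∈ labelings ] ∑[ b ∈ upTo c ] ∑[ i ∈ upTo t ] 𝟙 (exactly? i b l))
    ∑-N= c = trans
      (∑-cong (upTo c) λ b → trans
        (∑-cong (upTo t) λ i → #labelings≡∑ (preservedExactlyBy? G (exactly i b)))
        (∑-swap (upTo t) labelings λ i l → 𝟙 (exactly? i b l)))
      (∑-swap (upTo c) labelings λ b l → ∑[ i ∈ upTo t ] 𝟙 (exactly? i b l))

    dihedral-L : + L G k ≡ (∑[ P ∈ subsets G P⋆ ] (-1ℤ ^ length P * + N≥ G k P))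
      - (∑[ b ∈ upTo 2 ] ∑[ i ∈ upTo t ] (+ N= G k (exactly i b)))
    dihedral-L = begin
      + L G k
        ≡⟨ #labelings≡∑ (distinguishing? G) ⟩
      (∑[ l ∈ labelings ] 𝟙 (distinguishing? G (φ l)))
        ≡⟨ ∑-cong labelings (λ l → C.𝟙-distinguishing l (distinguishing? G (φ l))) ⟩
      (∑[ l ∈ labelings ] (𝟙 (nonePreserves? G (φ l) P⋆) - (∑[ b ∈ upTo 2 ] ∑[ i ∈ upTo t ] 𝟙 (exactly? i b l))))
        ≡⟨ ∑-- labelings (λ l → 𝟙 (nonePreserves? G (φ l) P⋆))
             (λ l → ∑[ b ∈ upTo 2 ] ∑[ i ∈ upTo t ] 𝟙 (exactly? i b l)) ⟩
      (∑[ l ∈ labelings ] 𝟙 (nonePreserves? G (φ l) P⋆))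
        - (∑[ l ∈ labelings ] ∑[ b ∈ upTo 2 ] ∑[ i ∈ upTo t ] 𝟙 (exactly? i b l))
        ≡⟨ cong₂ _-_ (∑-subsets-N≥ G k P⋆) (∑-N= 2) ⟨
      (∑[ P ∈ subsets G P⋆ ] (-1ℤ ^ length P * + N≥ G k P))
        - (∑[ b ∈ upTo 2 ] ∑[ i ∈ upTo t ] (+ N= G k (exactly i b))) ∎
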